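{- Let $m\ge 3$ be an integer and let $D\subset\{0,1,\dots,m-1\}$ with $1<\#D<m$. Let $p_0$ be a prime with $p_0\nmid m$, and let $t=t(m,p_0)$ be the overhead parameter and $c_{m,D}$ the constant defined in the context. Let $Q\ge 2$ be an integer with $\gcd(Q,m)=1$, and let $r$ be an integer with $0<r<Q$ and $\gcd(mr,Q)=1$. If $\frac{r}{Q}\in K_{m,D}$, then $$\nu_{p_0}(Q)\le t+\nu_{p_0}\bigl(\operatorname{ord}_{\operatorname{rad}(Q)}(m)\bigr)+\log_{p_0}(c_{m,D}).$$ Equivalently, $$\nu_{p_0}(Q)\le t+\max_{p\mid Q}\bigl\{\nu_{p_0}\bigl(\operatorname{ord}_p(m)\bigr)\bigr\}+\log_{p_0}(c_{m,D}),$$ where the maximum is over the prime divisors $p$ of $Q$.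
   Context: The missing-digit set is $K_{m,D}:=\left\{\sum_{j=1}^\infty \frac{a_j}{m^j}: a_j\in D\text{ for all }j\ge 1\right\}\subset[0,1]$. For a prime $p$, $\nu_p$ denotes the $p$-adic valuation. For integers $u,q\ge 1$ with $\gcd(u,q)=1$, $\operatorname{ord}_q(u)$ is the multiplicative order of $u$ modulo $q$, with $\operatorname{ord}_1(u)=1$; $\operatorname{rad}(q)$ is the radical of $q$ (product of its distinct prime divisors). The constant is $$c_{m,D}:=2(m-1)\min\left\{1,\frac{\#D}{m-\#D}\right\}.$$ For a prime $p_0\nmid m$, the overhead parameter is $t(m,p_0):=\nu_{p_0}\bigl(m^{\operatorname{ord}_{p_0}(m)}-1\bigr)$ if $p_0$ is odd, and $t(m,2):=\nu_2(m^2-1)-1$ if $p_0=2$. -}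

module Defs where

open import Data.Nat.Base as ℕ
  using (ℕ; zero; suc; _∸_; _≤_; _<_; NonZero; >-nonZero)
open import Data.Nat.Properties as ℕ using (m^n≢0; m<n⇒0<n∸m)
open import Data.Nat.Divisibility using (_∣_; _∣?_)
open import Data.Nat.Primality using (prime?)
open import Data.Nat.ListAction using (product)
open import Data.Integer.Base using (ℤ; +_; -[1+_])
open import Data.Rational.Base as ℚ
  using (ℚ; 0ℚ; 1ℚ; _/_; _⊓_; ↥_; ↧ₙ_; +-*-rawSemiring)
open import Algebra.Definitions.RawSemiring +-*-rawSemiring using (_^_)
open import Data.Fin.Base using (Fin; toℕ)
open import Data.Fin.Subset using (Subset; _∈_; ∣_∣)
open import Data.List.Base using (List; map; filter; upTo; applyUpTo)
open import Data.List.Extrema.Nat using (min; max)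
open import Data.Product.Base using (Σ-syntax; _×_)
open import Relation.Nullary.Decidable using (yes; no; _×-dec_)

------------------------------------------------------------------------
-- Missing-digit sets

-- Σ_{j=1}^{n} a_j / m^j.  The value a 0 is never used.
partialSum : (m : ℕ) .{{_ : NonZero m}} → (ℕ → Fin m) → ℕ → ℚ
partialSum m a zero    = 0ℚ
partialSum m a (suc n) =
  partialSum m a n ℚ.+ _/_ (+ toℕ (a (suc n))) (m ℕ.^ suc n) {{m^n≢0 m (suc n)}}

_convergesTo_ : (ℕ → ℚ) → ℚ → Set
s convergesTo x =
  ∀ (ε : ℚ) → 0ℚ ℚ.< ε →
  Σ[ N ∈ ℕ ] (∀ n → N ≤ n → ℚ.∣ s n ℚ.- x ∣ ℚ.< ε)

-- The rational points of K_{m,D}: since the partial sums are rational, a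
-- rational x is the real sum of the series exactly when they converge to x
-- within ℚ.
K : (m : ℕ) .{{_ : NonZero m}} → Subset m → ℚ → Set
K m D x =
  Σ[ a ∈ (ℕ → Fin m) ]
    (∀ j → 1 ≤ j → a j ∈ D) × (partialSum m a convergesTo x)

------------------------------------------------------------------------
-- Arithmetic functions

-- The largest k with p ^ k ∣ n, for p ≥ 2 and n ≥ 1.  Searching k < n is
-- enough because k < p ^ k ≤ n, and k = 0 always qualifies, so the default
-- value 0 of max plays no role.
ν : ℕ → ℕ → ℕ
ν p n = max 0 (filter (λ k → p ℕ.^ k ∣? n) (upTo n))

-- The least k ≥ 1 with u ^ k ≡ 1 (mod q), for u, q ≥ 1 and gcd(u,q) = 1.  The
-- order is at most q, so k ranges over 1, …, q and the default value q of min
-- plays no role; u ≥ 1 makes the truncated subtraction exact.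
ord : ℕ → ℕ → ℕ
ord q u = min q (filter (λ k → q ∣? (u ℕ.^ k ∸ 1)) (applyUpTo suc q))

-- For q ≥ 1, each prime divisor of q occurs exactly once.
primeDivisors : ℕ → List ℕ
primeDivisors q = filter (λ p → prime? p ×-dec (p ∣? q)) (upTo (suc q))

rad : ℕ → ℕ
rad q = product (primeDivisors q)

-- Maximum of f over the prime divisors of q.  For q ≥ 2 there is at least one
-- and f ≥ 0, so the default value 0 plays no role.
maxOverPrimeDivisors : (ℕ → ℕ) → ℕ → ℕ
maxOverPrimeDivisors f q = max 0 (map f (primeDivisors q))

overhead : ℕ → ℕ → ℕ
overhead m p₀ with p₀ ℕ.≟ 2
... | yes _ = ν 2 (m ℕ.^ 2 ∸ 1) ∸ 1
... | no  _ = ν p₀ (m ℕ.^ ord p₀ m ∸ 1)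

c : (m : ℕ) (D : Subset m) → .(∣ D ∣ < m) → ℚ
c m D #D<m =
  (+ (2 ℕ.* (m ∸ 1)) / 1)
    ℚ.* (1ℚ ⊓ _/_ (+ ∣ D ∣) (m ∸ ∣ D ∣) {{>-nonZero (m<n⇒0<n∸m #D<m)}})

------------------------------------------------------------------------
-- Real logarithms

-- A real number x, given by its set of rational lower bounds {q ∈ ℚ ∣ q ≤ x}.
Cut : Set₁
Cut = ℚ → Set

infix  4 _^ᶻ_≤_ _≤ᶜ_
infixr 6 _⊕_

-- p ^ e ≤ y for an integer exponent e and p ≥ 1; for e < 0 the inequality is
-- multiplied through by p ^ (- e).
_^ᶻ_≤_ : ℕ → ℤ → ℚ → Set
p ^ᶻ + k      ≤ y = (+ p / 1) ^ k ℚ.≤ y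
p ^ᶻ -[1+ k ] ≤ y = 1ℚ ℚ.≤ (+ p / 1) ^ suc k ℚ.* y

-- log p y is log_p(y), for p ≥ 2 and y > 0: a rational a / b with b > 0
-- satisfies a / b ≤ log_p(y) exactly when p ^ a ≤ y ^ b.
log : ℕ → ℚ → Cut
log p y q = p ^ᶻ ↥ q ≤ (y ^ ↧ₙ q)

-- The real number n + x.
_⊕_ : ℕ → Cut → Cut
(n ⊕ x) q = x (q ℚ.- (+ n / 1))

-- The order relation n ≤ x.
_≤ᶜ_ : ℕ → Cut → Set
n ≤ᶜ x = x (+ n / 1)

{-# OPTIONS --safe #-}
-- Multiplication by m shifts base-m digits, so for every k the first digit of the
-- fractional part of m ^ k r / Q lies in D.  Fix a prime p ∤ m and write
-- Q = p ^ v Q′ with p ∤ Q′.  Choose o with p ∣ m ^ o − 1, let τ = ν_p (m ^ o − 1), and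
-- let W satisfy ν_p (W) = e and m ^ W ≡ 1 modulo every prime divisor of Q.  Then
-- x = m ^ (o W Q′) is 1 modulo G = p ^ (τ + e) Q′, and by lifting the exponent its
-- first N = Q / G powers are distinct modulo Q (unless v ≤ τ + e, which is trivial).  So the fractional parts of
-- x ^ i r / Q form an arithmetic progression of N points spaced by 1 / N.  The
-- interval of length 1 / m belonging to a missing digit contains none of them, so
-- N ≤ m; but then different points have different first digits, so
-- N ≤ #D ≤ c_{m,D} / 2.
module Submission where

open import Defs
open import Data.Nat.Base hiding (_/_; +-*-rawSemiring)
open import Data.Nat.Properties
open import Data.Nat.Divisibility
open import Data.Nat.Primality
open import Data.Nat.Coprimality using (Coprime; coprime-divisor; gcd≡1⇒coprime)
import Data.Nat.DivMod as ℕ using (_/_)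
open import Data.Nat.DivMod
  using (_%_; m≡m%n+[m/n]*n; m%n<n; m/n*n≤m; m<n*o⇒m/o<n; m∣n⇒o%n%m≡o%m; %-remove-+ʳ)
open import Data.Nat.GCD using (gcd)
open import Data.Nat.ListAction using (product)
open import Data.Nat.ListAction.Properties using (∈⇒∣product)
open import Data.Nat.Primality.Factorisation using (factorise; module PrimeFactorisation)
open import Data.Nat.Tactic.RingSolver using (solve-∀)
open import Data.Integer.Base using (ℤ; +_; -[1+_])
import Data.Integer.Base as ℤ
import Data.Integer.Properties as ℤ
open import Data.Integer.Tactic.RingSolver using () renaming (solve-∀ to ℤ-solve-∀)
open import Data.Rational.Base as ℚ using (ℚ; 0ℚ; 1ℚ; mkℚ; toℚᵘ; _/_; +-*-rawSemiring)
import Data.Rational.Properties as ℚ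
open import Data.Rational.Unnormalised.Base as ℚᵘ using (mkℚᵘ; *≤*; *≡*)
import Data.Rational.Unnormalised.Properties as ℚᵘ
import Algebra.Definitions.RawSemiring +-*-rawSemiring as ℚ^
open import Algebra.Properties.Group ℚ.+-0-group using (⁻¹-involutive)
open import Data.Fin.Base using (Fin; zero; suc; toℕ; fromℕ<; punchOut)
open import Data.Fin.Properties
  using (pigeonhole; toℕ<n; toℕ-injective; toℕ-fromℕ<; injective⇒≤; any?; punchOut-injective)
import Data.Fin.Properties as Fin
open import Data.Fin.Subset using (Subset; ∣_∣; _∈_; _∉_; inside; outside; ⊤)
open import Data.Fin.Subset.Properties using (_∈?_; ∣⊤∣≡n; p⊆q⇒∣p∣≤∣q∣)
open import Data.Vec.Base using ([]; _∷_; here; there)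
open import Data.List.Base using ([]; _∷_; filter; upTo; applyUpTo)
open import Data.List.Extrema.Nat using (min; argmin-sel; argmax-sel; min≤xs; xs≤max)
import Data.List.Membership.Propositional as List
open import Data.List.Membership.Propositional.Properties
  using (∈-filter⁺; ∈-filter⁻; ∈-upTo⁺; ∈-applyUpTo⁺; ∈-applyUpTo⁻; ∈-map⁺)
open import Data.List.Relation.Unary.All as All using (All; []; _∷_)
open import Data.Product.Base
open import Data.Sum.Base using (_⊎_; inj₁; inj₂; [_,_]′)
open import Data.Empty using (⊥-elim)
open import Function.Base using (_∘_; id; it)
open import Function.Definitions using (Injective)
open import Relation.Nullary
open import Relation.Nullary.Decidable using (_×-dec_; ¬?; decidable-stable)
open import Relation.Binary.Definitions using (tri<; tri≈; tri>)
open import Relation.Binary.PropositionalEquality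

-- Lifting the exponent

geo : ℕ → ℕ → ℕ
geo g zero    = 0
geo g (suc k) = suc (g * geo g k)

-- This is (1 + h)^k - 1. Writing it as h times the geometric sum `geo` avoids truncated subtraction
-- and makes divisibility by h immediate.
powPred : ℕ → ℕ → ℕ
powPred h k = h * geo (suc h) k

suc-^ : ∀ h k → suc h ^ k ≡ suc (powPred h k)
suc-^ h zero    = cong suc (sym (*-zeroʳ h))
suc-^ h (suc k) = trans (cong (suc h *_) (suc-^ h k)) (alg h (geo (suc h) k))
  where
  alg : ∀ h s → suc h * suc (h * s) ≡ suc (h * suc (suc h * s))
  alg = solve-∀

powPred≡ : ∀ h k → suc h ^ k ∸ 1 ≡ powPred h k
powPred≡ h k = cong (_∸ 1) (suc-^ h k)

-- Raising to the power a and then to the power b lets exponents be treated factor by factor: 1 + h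
-- is replaced by (1 + h)^a, again of the form 1 + h′.
powPred-* : ∀ h a b → powPred h (a * b) ≡ powPred (powPred h a) b
powPred-* h a b = suc-injective (begin
  suc (powPred h (a * b))          ≡⟨ suc-^ h (a * b) ⟨
  suc h ^ (a * b)                  ≡⟨ ^-*-assoc (suc h) a b ⟨
  (suc h ^ a) ^ b                  ≡⟨ cong (_^ b) (suc-^ h a) ⟩
  suc (powPred h a) ^ b            ≡⟨ suc-^ (powPred h a) b ⟩
  suc (powPred (powPred h a) b)    ∎)
  where open ≡-Reasoning

∣powPred : ∀ {d h} k → d ∣ h → d ∣ powPred h k
∣powPred k = ∣m⇒∣m*n _

∣powPred-* : ∀ {d} h a b → d ∣ powPred h a → d ∣ powPred h (a * b)
∣powPred-* {d} h a b d∣ = subst (d ∣_) (sym (powPred-* h a b)) (∣powPred b d∣)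

-- Each term (1 + h)^i of the geometric sum is 1 + h times `geo (suc h) i`. Summing over i < k gives
-- k plus h times `geoSum h k`, the expansion used below.
geoSum : ℕ → ℕ → ℕ
geoSum h zero    = 0
geoSum h (suc k) = geo (suc h) k + geoSum h k

geo-expand : ∀ h k → geo (suc h) k ≡ k + h * geoSum h k
geo-expand h zero    = sym (*-zeroʳ h)
geo-expand h (suc k) = begin
  suc (geo (suc h) k + h * geo (suc h) k)
    ≡⟨ cong (λ z → suc (z + h * geo (suc h) k)) (geo-expand h k) ⟩
  suc (k + h * geoSum h k + h * geo (suc h) k)
    ≡⟨ alg k h (geoSum h k) (geo (suc h) k) ⟩
  suc k + h * (geo (suc h) k + geoSum h k) ∎
  where
  open ≡-Reasoning
  alg : ∀ k h t s → suc (k + h * t + h * s) ≡ suc k + h * (s + t)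
  alg = solve-∀

-- geoSum h k ≡ k (k − 1) / 2 modulo h.
geoSum-expand : ∀ h k → Σ[ z ∈ ℕ ] 2 * geoSum h k + k ≡ k * k + h * z
geoSum-expand h zero    = 0 , sym (*-zeroʳ h)
geoSum-expand h (suc k) with geoSum-expand h k
... | z , eq = 2 * geoSum h k + z , (begin
  2 * (geo (suc h) k + geoSum h k) + suc k
    ≡⟨ cong (λ s → 2 * (s + geoSum h k) + suc k) (geo-expand h k) ⟩
  2 * (k + h * geoSum h k + geoSum h k) + suc k
    ≡⟨ alg₁ k h (geoSum h k) ⟩
  suc (2 * k + 2 * h * geoSum h k + (2 * geoSum h k + k))
    ≡⟨ cong (λ s → suc (2 * k + 2 * h * geoSum h k + s)) eq ⟩
  suc (2 * k + 2 * h * geoSum h k + (k * k + h * z))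
    ≡⟨ alg₂ k h (geoSum h k) z ⟩
  suc k * suc k + h * (2 * geoSum h k + z) ∎)
  where
  open ≡-Reasoning
  alg₁ : ∀ k h t → 2 * (k + h * t + t) + suc k ≡ suc (2 * k + 2 * h * t + (2 * t + k))
  alg₁ = solve-∀
  alg₂ : ∀ k h t z → suc (2 * k + 2 * h * t + (k * k + h * z)) ≡ suc k * suc k + h * (2 * t + z)
  alg₂ = solve-∀

prime≥2 : ∀ {p} → Prime p → 2 ≤ p
prime≥2 pr = nonTrivial⇒n>1 _ {{prime⇒nonTrivial pr}}

p∣2⇒p≡2 : ∀ {p} → Prime p → p ∣ 2 → p ≡ 2
p∣2⇒p≡2 pr p∣2 = ≤-antisym (∣⇒≤ p∣2) (prime≥2 pr)

-- The hypothesis under which lifting the exponent holds for 1 + h: it excludes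
-- h ≡ 2 modulo 4 at p = 2, where the valuation of (1 + h) ^ 2 − 1 can jump.
Liftable : ℕ → ℕ → Set
Liftable p h = p ∣ h × (p ≡ 2 → 4 ∣ h)

-- For p = 2 the factor 4 is already in h. For odd p, one factor p comes from h and the other from
-- `geoSum h p`, whose double is p (p - 1) modulo h.
p*p∣h*geoSum : ∀ {p h} → Prime p → Liftable p h → p * p ∣ h * geoSum h p
p*p∣h*geoSum {p} {h} pr (p∣h , 4∣h) with p ≟ 2
... | yes refl = ∣m⇒∣m*n (geoSum h 2) (4∣h refl)
... | no p≢2 with geoSum-expand h p
...   | z , eq = *-pres-∣ p∣h p∣T
  where
  p∣2T : p ∣ 2 * geoSum h p
  p∣2T = ∣m+n∣m⇒∣n (subst (p ∣_) (trans (sym eq) (+-comm (2 * geoSum h p) p)) (∣m∣n⇒∣m+n (m∣m*n p) (∣m⇒∣m*n z p∣h))) ∣-refl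
  p∣T : p ∣ geoSum h p
  p∣T with euclidsLemma 2 (geoSum h p) pr p∣2T
  ... | inj₁ p∣2 = ⊥-elim (p≢2 (p∣2⇒p≡2 pr p∣2))
  ... | inj₂ p∣t = p∣t

-- The correction to the leading term p is a multiple of p^2. So the geometric sum has exactly one
-- factor p, and a p-th power raises the valuation of h by exactly one.
geo-prime : ∀ {p h} → Prime p → Liftable p h → Σ[ z ∈ ℕ ] geo (suc h) p ≡ p * suc (p * z)
geo-prime {p} {h} pr lift with p*p∣h*geoSum {p} {h} pr lift
... | divides z eq = z , (begin
  geo (suc h) p         ≡⟨ geo-expand h p ⟩
  p + h * geoSum h p    ≡⟨ cong (λ z → p + z) eq ⟩
  p + z * (p * p)       ≡⟨ alg p z ⟩
  p * suc (p * z)       ∎)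
  where
  open ≡-Reasoning
  alg : ∀ p z → p + z * (p * p) ≡ p * suc (p * z)
  alg = solve-∀

p∤1+p* : ∀ {p} z → Prime p → ¬ (p ∣ suc (p * z))
p∤1+p* {p} z pr p∣ = ¬prime[1] (subst Prime (∣1⇒≡1 (∣m+n∣m⇒∣n (subst (p ∣_) (+-comm 1 (p * z)) p∣) (m∣m*n z))) pr)

p^k∣m*n⇒p^k∣n : ∀ {p} k {m n} → Prime p → ¬ (p ∣ m) → p ^ k ∣ m * n → p ^ k ∣ n
p^k∣m*n⇒p^k∣n zero    {n = n} pr p∤m _ = 1∣ n
p^k∣m*n⇒p^k∣n {p} (suc k) {m} {n} pr p∤m h
  with euclidsLemma m n pr (∣-trans (m∣m*n (p ^ k)) h)
... | inj₁ p∣m = ⊥-elim (p∤m p∣m)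
... | inj₂ (divides n′ refl) =
  subst (p * p ^ k ∣_) (*-comm p n′)
    (*-monoʳ-∣ p (p^k∣m*n⇒p^k∣n k pr p∤m
      (*-cancelˡ-∣ p {{prime⇒nonZero pr}} (subst (p * p ^ k ∣_) (alg m n′ p) h))))
  where
  alg : ∀ m n p → m * (n * p) ≡ p * (m * n)
  alg = solve-∀

p^[a+b]∣p^a*n : ∀ p a b {n} → .{{NonZero p}} → p ^ (a + b) ∣ p ^ a * n → p ^ b ∣ n
p^[a+b]∣p^a*n p a b h = *-cancelˡ-∣ (p ^ a) {{m^n≢0 p a}} (subst (_∣ _) (^-distribˡ-+-* p a b) h)

p^[a+b]∣m*n : ∀ {p} a b {m n} → Prime p → ¬ (p ∣ m) → p ^ (a + b) ∣ (p ^ a * m) * n → p ^ b ∣ n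
p^[a+b]∣m*n {p} a b {m} {n} pr p∤m h =
  p^k∣m*n⇒p^k∣n b pr p∤m
    (p^[a+b]∣p^a*n p a b {{prime⇒nonZero pr}} (subst (p ^ (a + b) ∣_) (*-assoc (p ^ a) m n) h))

-- Induction on s. The quotient of (1 + h)^k - 1 by h is k modulo h, so p divides it and hence k.
-- With k = k′ p, pass to (1 + h)^p and k′: the valuation τ grows by exactly one, and liftability
-- persists.
lte : ∀ {p} s τ u k → Prime p → ¬ (p ∣ u) → Liftable p (p ^ τ * u) →
      p ^ (τ + s) ∣ powPred (p ^ τ * u) k → p ^ s ∣ k
lte zero    τ u k pr p∤u lift h = 1∣ k
lte {p} (suc s) τ u k pr p∤u lift@(p∣h , 4∣h) h
  with ∣m+n∣m⇒∣n (subst (p ∣_) (trans (geo-expand (p ^ τ * u) k) (+-comm k _))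
         (∣-trans (m∣m*n (p ^ s)) (p^[a+b]∣m*n τ (suc s) {u} pr p∤u h)))
         (∣m⇒∣m*n (geoSum (p ^ τ * u) k) p∣h)
     | geo-prime {p} {p ^ τ * u} pr lift
... | divides k′ refl | z , eq =
  subst (p * p ^ s ∣_) (*-comm p k′)
    (*-monoʳ-∣ p (lte s (suc τ) u′ k′ pr p∤u′ lift′ h″))
  where
  u′ = u * suc (p * z)
  p∤u′ : ¬ (p ∣ u′)
  p∤u′ p∣u′ = [ p∤u , p∤1+p* z pr ]′ (euclidsLemma u _ pr p∣u′)
  alg : ∀ a u p w → a * u * (p * w) ≡ p * a * (u * w)
  alg = solve-∀
  eq′ : powPred (p ^ τ * u) p ≡ p ^ suc τ * u′
  eq′ = trans (cong (p ^ τ * u *_) eq) (alg (p ^ τ) u p (suc (p * z)))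
  lift′ : Liftable p (p ^ suc τ * u′)
  lift′ = subst (Liftable p) eq′ (∣powPred p p∣h , λ p≡2 → ∣powPred p (4∣h p≡2))
  h′ : p ^ (τ + suc s) ∣ powPred (powPred (p ^ τ * u) p) k′
  h′ = subst (p ^ (τ + suc s) ∣_)
         (trans (cong (powPred (p ^ τ * u)) (*-comm k′ p)) (powPred-* (p ^ τ * u) p k′)) h
  h″ : p ^ (suc τ + s) ∣ powPred (p ^ suc τ * u′) k′
  h″ = subst₂ (λ a b → p ^ a ∣ powPred b k′) (+-suc τ s) eq′ h′

-- The geometric sum of length q is q modulo h, so it is divisible by q when q divides h. Each q-th
-- power thus gains a factor q, and d accumulates the factors gained so far.
powPred-product : ∀ {d h} qs → d ∣ h → All (_∣ h) qs → d * product qs ∣ powPred h (product qs)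
powPred-product {d} {h} [] d∣h [] = subst (_∣ powPred h 1) (sym (*-identityʳ d)) (∣powPred 1 d∣h)
powPred-product {d} {h} (q ∷ qs) d∣h (q∣h ∷ qs∣h) =
  subst₂ _∣_ (*-assoc d q (product qs)) (sym (powPred-* h q (product qs)))
    (powPred-product qs
      (*-pres-∣ d∣h (subst (q ∣_) (sym (geo-expand h q)) (∣m∣n⇒∣m+n ∣-refl (∣m⇒∣m*n _ q∣h))))
      (All.map (∣powPred q) qs∣h))

p^k∣powPred : ∀ {p d h} k → p ∣ h → d ∣ h → d * p ^ k ∣ powPred h (p ^ k)
p^k∣powPred {p} {d} {h} zero p∣h d∣h = subst (_∣ powPred h 1) (sym (*-identityʳ d)) (∣powPred 1 d∣h)
p^k∣powPred {p} {d} {h} (suc k) p∣h d∣h =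
  subst₂ _∣_ (*-assoc d p (p ^ k)) (sym (powPred-* h p (p ^ k)))
    (p^k∣powPred k (∣powPred p p∣h)
      (*-pres-∣ d∣h (subst (p ∣_) (sym (geo-expand h p)) (∣m∣n⇒∣m+n ∣-refl (∣m⇒∣m*n _ p∣h)))))

n∣powPred-n : ∀ {h} n .{{_ : NonZero n}} → (∀ q → Prime q → q ∣ n → q ∣ h) → n ∣ powPred h n
n∣powPred-n {h} n hyp = subst (λ z → z ∣ powPred h z) (sym isFactorisation)
  (subst (_∣ powPred h (product factors)) (*-identityˡ (product factors))
    (powPred-product factors (1∣ h)
      (All.zipWith (λ (pr , q∣) → hyp _ pr (subst (_ ∣_) (sym isFactorisation) q∣))
        (factorsPrime , All.tabulate ∈⇒∣product))))
  where open PrimeFactorisation (factorise n)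

-- Valuations, prime divisors and multiplicative orders

n<m^n : ∀ {m} n → 2 ≤ m → n < m ^ n
n<m^n zero    2≤m = z<s
n<m^n {m} (suc n) 2≤m = begin
  suc (suc n)        ≤⟨ s≤s (n<m^n n 2≤m) ⟩
  suc (m ^ n)        ≤⟨ +-monoˡ-≤ (m ^ n) (≤-trans z<s (n<m^n n 2≤m)) ⟩
  m ^ n + m ^ n      ≡⟨ cong (λ z → m ^ n + z) (+-identityʳ (m ^ n)) ⟨
  2 * m ^ n          ≤⟨ *-monoˡ-≤ (m ^ n) 2≤m ⟩
  m * m ^ n          ∎
  where open ≤-Reasoning

p^ν∣n : ∀ p n → p ^ ν p n ∣ n
p^ν∣n p n with argmax-sel id 0 (filter (λ k → p ^ k ∣? n) (upTo n))
... | inj₁ eq = subst (λ k → p ^ k ∣ n) (sym eq) (1∣ n)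
... | inj₂ ∈f = proj₂ (∈-filter⁻ (λ k → p ^ k ∣? n) {xs = upTo n} ∈f)

p^k∣n⇒k≤ν : ∀ {p} n k .{{_ : NonZero n}} → 2 ≤ p → p ^ k ∣ n → k ≤ ν p n
p^k∣n⇒k≤ν {p} n k 2≤p p^k∣n =
  All.lookup (xs≤max 0 (filter (λ k → p ^ k ∣? n) (upTo n)))
    (∈-filter⁺ (λ k → p ^ k ∣? n) (∈-upTo⁺ (≤-trans (n<m^n k 2≤p) (∣⇒≤ p^k∣n))) p^k∣n)

ν-split : ∀ {p} n .{{_ : NonZero n}} → Prime p → Σ[ n′ ∈ ℕ ] n ≡ p ^ ν p n * n′ × ¬ (p ∣ n′)
ν-split {p} n pr with p^ν∣n p n
... | divides n′ eq = n′ , trans eq (*-comm n′ _) , λ p∣n′ →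
  1+n≰n (p^k∣n⇒k≤ν n (suc (ν p n)) (prime≥2 pr) (subst (p * p ^ ν p n ∣_) (sym eq) (*-monoˡ-∣ (p ^ ν p n) p∣n′)))

∈primeDivisors : ∀ {p n} .{{_ : NonZero n}} → Prime p → p ∣ n → p List.∈ primeDivisors n
∈primeDivisors {n = n} pr p∣n =
  ∈-filter⁺ (λ p → prime? p ×-dec (p ∣? n)) (∈-upTo⁺ (s≤s (∣⇒≤ p∣n))) (pr , p∣n)

primeDivisors-All : ∀ n → All (λ p → Prime p × p ∣ n) (primeDivisors n)
primeDivisors-All n = All.tabulate (λ ∈f → proj₂ (∈-filter⁻ (λ p → prime? p ×-dec (p ∣? n)) {xs = upTo (suc n)} ∈f))

p^k*n∣ : ∀ {p} k {n x} → Prime p → ¬ (p ∣ n) → p ^ k ∣ x → n ∣ x → p ^ k * n ∣ x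
p^k*n∣ {p} k {n} pr p∤n p^k∣x (divides y refl) =
  *-monoˡ-∣ n (p^k∣m*n⇒p^k∣n k pr p∤n (subst (p ^ k ∣_) (*-comm y n) p^k∣x))

coprime-∣ˡ : ∀ {a b n} → a ∣ b → Coprime b n → Coprime a n
coprime-∣ˡ a∣b cop (d∣a , d∣n) = cop (∣-trans d∣a a∣b , d∣n)

product-coprime : ∀ {n m} qs → All (_∣ n) qs → Coprime n m → Coprime (product qs) m
product-coprime []       []           cop (d∣1 , _)    = ∣1⇒≡1 d∣1
product-coprime (q ∷ qs) (q∣n ∷ qs∣n) cop (d∣q*Π , d∣m) = product-coprime qs qs∣n cop
  (coprime-divisor (λ (x , y) → cop (∣-trans y q∣n , ∣-trans x d∣m)) d∣q*Π , d∣m)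

coprime-^ : ∀ {q u} n → Coprime q u → Coprime q (u ^ n)
coprime-^ zero    cop (_ , d∣1) = ∣1⇒≡1 d∣1
coprime-^ (suc n) cop (d∣q , d∣u*u^n) =
  coprime-^ n cop (d∣q , coprime-divisor (λ (x , y) → cop (∣-trans x d∣q , y)) d∣u*u^n)

%≡⇒∣ : ∀ {q} a b .{{_ : NonZero q}} → a % q ≡ (a + b) % q → q ∣ b
%≡⇒∣ {q} a b eq = ∣m+n∣m⇒∣n
  (divides ((a + b) ℕ./ q) (+-cancelˡ-≡ (a % q) _ _ (begin
    a % q + ((a ℕ./ q) * q + b)              ≡⟨ +-assoc (a % q) _ b ⟨
    a % q + (a ℕ./ q) * q + b                ≡⟨ cong (_+ b) (m≡m%n+[m/n]*n a q) ⟨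
    a + b                                  ≡⟨ m≡m%n+[m/n]*n (a + b) q ⟩
    (a + b) % q + ((a + b) ℕ./ q) * q        ≡⟨ cong (_+ ((a + b) ℕ./ q) * q) eq ⟨
    a % q + ((a + b) ℕ./ q) * q              ∎)))
  (n∣m*n (a ℕ./ q))
  where open ≡-Reasoning

suc-^-+ : ∀ h a b → suc h ^ (a + b) ≡ suc h ^ a + suc h ^ a * powPred h b
suc-^-+ h a b = trans (^-distribˡ-+-* (suc h) a b)
  (trans (cong (suc h ^ a *_) (suc-^ h b)) (*-suc (suc h ^ a) (powPred h b)))

-- Two of the q + 1 powers u ^ 0, …, u ^ q agree modulo q.
∃order : ∀ q h .{{_ : NonZero q}} → Coprime q (suc h) →
         Σ[ k ∈ ℕ ] k < q × q ∣ powPred h (suc k)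
∃order q h cop with pigeonhole (n<1+n q) (λ i → fromℕ< (m%n<n (suc h ^ toℕ i) q))
... | i , j , i<j , fi≡fj with m≤n⇒∃[o]m+o≡n i<j
...   | k , 1+i+k≡j = k , k<q , coprime-divisor (coprime-^ (toℕ i) cop) (%≡⇒∣ (u ^ toℕ i) _ %eq)
  where
  u = suc h
  k<q : k < q
  k<q = ≤-trans (s≤s (m≤n+m k (toℕ i))) (≤-trans (≤-reflexive 1+i+k≡j) (s≤s⁻¹ (toℕ<n j)))
  %eq : u ^ toℕ i % q ≡ (u ^ toℕ i + u ^ toℕ i * powPred h (suc k)) % q
  %eq = begin
    u ^ toℕ i % q                          ≡⟨ toℕ-fromℕ< (m%n<n (u ^ toℕ i) q) ⟨
    toℕ (fromℕ< (m%n<n (u ^ toℕ i) q))     ≡⟨ cong toℕ fi≡fj ⟩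
    toℕ (fromℕ< (m%n<n (u ^ toℕ j) q))     ≡⟨ toℕ-fromℕ< (m%n<n (u ^ toℕ j) q) ⟩
    u ^ toℕ j % q                          ≡⟨ cong (λ z → u ^ z % q) (trans (+-suc (toℕ i) k) 1+i+k≡j) ⟨
    u ^ (toℕ i + suc k) % q                ≡⟨ cong (_% q) (suc-^-+ h (toℕ i) (suc k)) ⟩
    (u ^ toℕ i + u ^ toℕ i * powPred h (suc k)) % q  ∎
    where open ≡-Reasoning

ord-spec : ∀ q h .{{_ : NonZero q}} → Coprime q (suc h) →
           NonZero (ord q (suc h)) × q ∣ powPred h (ord q (suc h))
ord-spec q h cop = prove (argmin-sel id q ks)
  where
  P? = λ k → q ∣? (suc h ^ k ∸ 1)
  ks = filter P? (applyUpTo suc q)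
  Good : ℕ → Set
  Good o = NonZero o × q ∣ powPred h o
  good : ∀ {k} → k List.∈ ks → Good k
  good {k} k∈ with ∈-filter⁻ P? {xs = applyUpTo suc q} k∈
  ... | k∈suc , q∣ with ∈-applyUpTo⁻ suc {n = q} k∈suc
  ...   | _ , _ , refl = _ , subst (q ∣_) (powPred≡ h k) q∣
  prove : min q ks ≡ q ⊎ min q ks List.∈ ks → Good (min q ks)
  prove (inj₂ ∈ks) = good ∈ks
  -- Even when the minimum equals the default q, some exponent `suc k` with k < q is in the list.
  -- Minimality then forces `suc k` to equal q, so q itself qualifies.
  prove (inj₁ min≡q) with ∃order q h cop
  ... | k , k<q , q∣ = subst Good (sym min≡suck) (good k∈)
    where
    k∈ : suc k List.∈ ks
    k∈ = ∈-filter⁺ P? (∈-applyUpTo⁺ suc k<q) (subst (q ∣_) (sym (powPred≡ h (suc k))) q∣)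
    min≡suck : min q ks ≡ suc k
    min≡suck = ≤-antisym (All.lookup (min≤xs q ks) k∈) (subst (suc k ≤_) (sym min≡q) k<q)

-- Rational approximations and logarithms

frac : (a b : ℕ) → .{{NonZero b}} → ℚ
frac a b = (+ a) / b

toℚᵘ-frac : ∀ a b → toℚᵘ (frac a (suc b)) ℚᵘ.≃ mkℚᵘ (+ a) b
toℚᵘ-frac a b = ℚ.toℚᵘ-fromℚᵘ (mkℚᵘ (+ a) b)

frac-≤ : ∀ a b c d .{{_ : NonZero b}} .{{_ : NonZero d}} → a * d ≤ c * b → frac a b ℚ.≤ frac c d
frac-≤ a (b@(suc b-1)) c (d@(suc d-1)) ad≤cb = ℚ.toℚᵘ-cancel-≤
  (ℚᵘ.≤-respˡ-≃ (ℚᵘ.≃-sym (toℚᵘ-frac a b-1)) (ℚᵘ.≤-respʳ-≃ (ℚᵘ.≃-sym (toℚᵘ-frac c d-1))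
    (*≤* (subst₂ ℤ._≤_ (ℤ.pos-* a d) (ℤ.pos-* c b) (ℤ.+≤+ ad≤cb)))))

frac-≤⁻ : ∀ a b c d .{{_ : NonZero b}} .{{_ : NonZero d}} → frac a b ℚ.≤ frac c d → a * d ≤ c * b
frac-≤⁻ a (b@(suc b-1)) c (d@(suc d-1)) le = ℤ.drop‿+≤+
  (subst₂ ℤ._≤_ (sym (ℤ.pos-* a d)) (sym (ℤ.pos-* c b))
    (ℚᵘ.drop-*≤* (ℚᵘ.≤-respˡ-≃ (toℚᵘ-frac a b-1) (ℚᵘ.≤-respʳ-≃ (toℚᵘ-frac c d-1) (ℚ.toℚᵘ-mono-≤ le)))))

frac-≡ : ∀ a b c d .{{_ : NonZero b}} .{{_ : NonZero d}} → a * d ≡ c * b → frac a b ≡ frac c d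
frac-≡ a b c d ad≡cb =
  ℚ.≤-antisym (frac-≤ a b c d (≤-reflexive ad≡cb)) (frac-≤ c d a b (≤-reflexive (sym ad≡cb)))

frac-+ : ∀ a b c d .{{_ : NonZero b}} .{{_ : NonZero d}} .{{_ : NonZero (b * d)}} →
         frac a b ℚ.+ frac c d ≡ frac (a * d + c * b) (b * d)
frac-+ a b@(suc b-1) c d@(suc d-1) = ℚ.toℚᵘ-injective (begin
  toℚᵘ (frac a b ℚ.+ frac c d)          ≈⟨ ℚ.toℚᵘ-homo-+ (frac a b) (frac c d) ⟩
  toℚᵘ (frac a b) ℚᵘ.+ toℚᵘ (frac c d)  ≈⟨ ℚᵘ.+-cong (toℚᵘ-frac a b-1) (toℚᵘ-frac c d-1) ⟩
  mkℚᵘ (+ a) b-1 ℚᵘ.+ mkℚᵘ (+ c) d-1    ≈⟨ *≡* (cong (ℤ._* (+ (b * d))) (cong₂ ℤ._+_ (sym (ℤ.pos-* a d)) (sym (ℤ.pos-* c b)))) ⟩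
  mkℚᵘ (+ (a * d + c * b)) (d-1 + b-1 * d) ≈⟨ toℚᵘ-frac (a * d + c * b) (d-1 + b-1 * d) ⟨
  toℚᵘ (frac (a * d + c * b) (b * d))   ∎)
  where open ℚᵘ.≃-Reasoning

frac-* : ∀ a b c d .{{_ : NonZero b}} .{{_ : NonZero d}} .{{_ : NonZero (b * d)}} →
         frac a b ℚ.* frac c d ≡ frac (a * c) (b * d)
frac-* a b@(suc b-1) c d@(suc d-1) = ℚ.toℚᵘ-injective (begin
  toℚᵘ (frac a b ℚ.* frac c d)          ≈⟨ ℚ.toℚᵘ-homo-* (frac a b) (frac c d) ⟩
  toℚᵘ (frac a b) ℚᵘ.* toℚᵘ (frac c d)  ≈⟨ ℚᵘ.*-cong (toℚᵘ-frac a b-1) (toℚᵘ-frac c d-1) ⟩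
  mkℚᵘ (+ a) b-1 ℚᵘ.* mkℚᵘ (+ c) d-1    ≈⟨ *≡* (cong (ℤ._* (+ (b * d))) (sym (ℤ.pos-* a c))) ⟩
  mkℚᵘ (+ (a * c)) (d-1 + b-1 * d)      ≈⟨ toℚᵘ-frac (a * c) (d-1 + b-1 * d) ⟨
  toℚᵘ (frac (a * c) (b * d))           ∎)
  where open ℚᵘ.≃-Reasoning

frac-^ : ∀ p k → frac p 1 ℚ^.^ k ≡ frac (p ^ k) 1
frac-^ p zero    = refl
frac-^ p (suc k) = trans (cong (frac p 1 ℚ.*_) (frac-^ p k)) (frac-* p 1 (p ^ k) 1)

p≤∣p∣ : ∀ p → p ℚ.≤ ℚ.∣ p ∣
p≤∣p∣ p with ℚ.∣p∣≡p∨∣p∣≡-p p | ℚ.≤-total 0ℚ p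
... | inj₁ eq | _ = ℚ.≤-reflexive (sym eq)
... | inj₂ _  | inj₁ 0≤p = ℚ.≤-reflexive (sym (ℚ.0≤p⇒∣p∣≡p 0≤p))
... | inj₂ _  | inj₂ p≤0 = ℚ.≤-trans p≤0 (ℚ.0≤∣p∣ p)

p<q⇒0<q-p : ∀ {p q} → p ℚ.< q → 0ℚ ℚ.< q ℚ.- p
p<q⇒0<q-p {p} {q} p<q = subst (ℚ._< q ℚ.- p) (ℚ.+-inverseʳ p) (ℚ.+-monoˡ-< (ℚ.- p) p<q)

-- If x were below A, late terms would differ from x by at least A - x, against convergence with
-- tolerance A - x.
limit-≥ : ∀ {s x A} k → s convergesTo x → (∀ n → k ≤ n → A ℚ.≤ s n) → A ℚ.≤ x
limit-≥ {s} {x} {A} k conv A≤s = ℚ.≮⇒≥ λ x<A →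
  let N , close = conv (A ℚ.- x) (p<q⇒0<q-p x<A)
      n = k ⊔ N
  in ℚ.<-irrefl refl (ℚ.≤-<-trans
       (ℚ.≤-trans (ℚ.+-monoˡ-≤ (ℚ.- x) (A≤s n (m≤m⊔n k N))) (p≤∣p∣ (s n ℚ.- x)))
       (close n (m≤n⊔m k N)))

∣p-q∣≡∣q-p∣ : ∀ p q → ℚ.∣ p ℚ.- q ∣ ≡ ℚ.∣ q ℚ.- p ∣
∣p-q∣≡∣q-p∣ p q = trans (sym (ℚ.∣-p∣≡∣p∣ (p ℚ.- q))) (cong ℚ.∣_∣ (begin
  ℚ.- (p ℚ.- q)             ≡⟨ ℚ.neg-distrib-+ p (ℚ.- q) ⟩
  ℚ.- p ℚ.+ ℚ.- (ℚ.- q)     ≡⟨ ℚ.+-comm (ℚ.- p) _ ⟩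
  ℚ.- (ℚ.- q) ℚ.- p         ≡⟨ cong (ℚ._- p) (⁻¹-involutive q) ⟩
  q ℚ.- p                   ∎))
  where
  open ≡-Reasoning

limit-≤ : ∀ {s x B} k → s convergesTo x → (∀ n → k ≤ n → s n ℚ.≤ B) → x ℚ.≤ B
limit-≤ {s} {x} {B} k conv s≤B = ℚ.≮⇒≥ λ B<x →
  let N , close = conv (x ℚ.- B) (p<q⇒0<q-p B<x)
      n = k ⊔ N
  in ℚ.<-irrefl refl (ℚ.≤-<-trans
       (ℚ.≤-trans (ℚ.+-monoʳ-≤ x (ℚ.neg-antimono-≤ (s≤B n (m≤m⊔n k N)))) (p≤∣p∣ (x ℚ.- s n)))
       (subst (ℚ._< x ℚ.- B) (∣p-q∣≡∣q-p∣ (s n) x) (close n (m≤n⊔m k N))))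

-- The integer with base-m digits a 1, ..., a n, which is m^n times the partial sum.
numerator : ∀ m → (ℕ → Fin m) → ℕ → ℕ
numerator m a zero    = 0
numerator m a (suc n) = m * numerator m a n + toℕ (a (suc n))

module _ (m : ℕ) .{{_ : NonZero m}} (a : ℕ → Fin m) where

  private
    _/m^_ : ℕ → ℕ → ℚ
    b /m^ n = frac b (m ^ n) {{m^n≢0 m n}}

  partialSum≡ : ∀ n → partialSum m a n ≡ numerator m a n /m^ n
  partialSum≡ zero    = refl
  partialSum≡ (suc n) = begin
    partialSum m a n ℚ.+ d /m^ suc n   ≡⟨ cong (ℚ._+ d /m^ suc n) (partialSum≡ n) ⟩
    M /m^ n ℚ.+ d /m^ suc n            ≡⟨ frac-+ M (m ^ n) d (m ^ suc n) ⟩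
    frac (M * m ^ suc n + d * m ^ n) (m ^ n * m ^ suc n)
                                       ≡⟨ frac-≡ (M * m ^ suc n + d * m ^ n) (m ^ n * m ^ suc n) (m * M + d) (m ^ suc n) (alg M m (m ^ n) d) ⟩
    (m * M + d) /m^ suc n              ∎
    where
    open ≡-Reasoning
    M = numerator m a n
    d = toℕ (a (suc n))
    instance
      nz₁ : NonZero (m ^ n)
      nz₁ = m^n≢0 m n
      nz₂ : NonZero (m ^ suc n)
      nz₂ = m^n≢0 m (suc n)
      nz₃ : NonZero (m ^ n * m ^ suc n)
      nz₃ = m*n≢0 (m ^ n) (m ^ suc n)
    alg : ∀ M m x d → (M * (m * x) + d * x) * (m * x) ≡ (m * M + d) * (x * (m * x))
    alg = solve-∀

  numerator-lower : ∀ k j → numerator m a k * m ^ (j + k) ≤ numerator m a (j + k) * m ^ k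
  numerator-lower k zero    = ≤-refl
  numerator-lower k (suc j) = begin
    M * (m * m ^ (j + k))          ≡⟨ alg M m (m ^ (j + k)) ⟩
    m * (M * m ^ (j + k))          ≤⟨ *-monoʳ-≤ m (numerator-lower k j) ⟩
    m * (M′ * m ^ k)               ≡⟨ *-assoc m M′ (m ^ k) ⟨
    m * M′ * m ^ k                 ≤⟨ *-monoˡ-≤ (m ^ k) (m≤m+n (m * M′) d) ⟩
    (m * M′ + d) * m ^ k           ∎
    where
    open ≤-Reasoning
    M = numerator m a k
    M′ = numerator m a (j + k)
    d = toℕ (a (suc (j + k)))
    alg : ∀ M m x → M * (m * x) ≡ m * (M * x)
    alg = solve-∀

  -- Since digits are at most m - 1, the upper ends (M + 1) / m^n of the digit intervals do not
  -- increase with n. The successor on the left carries the induction through each digit.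
  numerator-upper : ∀ k j → suc (numerator m a (j + k)) * m ^ k ≤ suc (numerator m a k) * m ^ (j + k)
  numerator-upper k zero    = ≤-refl
  numerator-upper k (suc j) = begin
    suc (m * M′ + d) * m ^ k       ≡⟨ cong (_* m ^ k) (+-suc (m * M′) d) ⟨
    (m * M′ + suc d) * m ^ k       ≤⟨ *-monoˡ-≤ (m ^ k) (+-monoʳ-≤ (m * M′) (toℕ<n (a (suc (j + k))))) ⟩
    (m * M′ + m) * m ^ k           ≡⟨ alg₁ m M′ (m ^ k) ⟩
    m * (suc M′ * m ^ k)           ≤⟨ *-monoʳ-≤ m (numerator-upper k j) ⟩
    m * (suc M * m ^ (j + k))      ≡⟨ alg₂ M m (m ^ (j + k)) ⟩
    suc M * (m * m ^ (j + k))      ∎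
    where
    open ≤-Reasoning
    M = numerator m a k
    M′ = numerator m a (j + k)
    d = toℕ (a (suc (j + k)))
    alg₁ : ∀ m M x → (m * M + m) * x ≡ m * (suc M * x)
    alg₁ = solve-∀
    alg₂ : ∀ M m x → m * (suc M * x) ≡ suc M * (m * x)
    alg₂ = solve-∀

  partialSum-lower : ∀ k n → k ≤ n → numerator m a k /m^ k ℚ.≤ partialSum m a n
  partialSum-lower k n k≤n = subst (λ n → numerator m a k /m^ k ℚ.≤ partialSum m a n) (m∸n+n≡m k≤n)
    (subst (numerator m a k /m^ k ℚ.≤_) (sym (partialSum≡ (j + k)))
      (frac-≤ (numerator m a k) (m ^ k) (numerator m a (j + k)) (m ^ (j + k)) {{m^n≢0 m k}} {{m^n≢0 m (j + k)}} (numerator-lower k j)))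
    where j = n ∸ k

  partialSum-upper : ∀ k n → k ≤ n → partialSum m a n ℚ.≤ suc (numerator m a k) /m^ k
  partialSum-upper k n k≤n = subst (λ n → partialSum m a n ℚ.≤ suc (numerator m a k) /m^ k) (m∸n+n≡m k≤n)
    (subst (ℚ._≤ suc (numerator m a k) /m^ k) (sym (partialSum≡ (j + k)))
      (frac-≤ (numerator m a (j + k)) (m ^ (j + k)) (suc (numerator m a k)) (m ^ k) {{m^n≢0 m (j + k)}} {{m^n≢0 m k}}
        (≤-trans (*-monoˡ-≤ (m ^ k) (n≤1+n (numerator m a (j + k)))) (numerator-upper k j))))
    where j = n ∸ k

  limit-bounds : ∀ r Q .{{_ : NonZero Q}} → partialSum m a convergesTo frac r Q → ∀ k →
    numerator m a k * Q ≤ r * m ^ k × r * m ^ k ≤ suc (numerator m a k) * Q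
  limit-bounds r Q conv k =
    frac-≤⁻ (numerator m a k) (m ^ k) r Q {{m^n≢0 m k}} (limit-≥ k conv (partialSum-lower k)) ,
    frac-≤⁻ r Q (suc (numerator m a k)) (m ^ k) {{it}} {{m^n≢0 m k}} (limit-≤ k conv (partialSum-upper k))

-- If the minimum is 1, use that `∣ D ∣` is at most the modulus minus 1. Otherwise use the same
-- bound for the modulus minus `∣ D ∣`, which holds because D is nonempty.
c-lower : ∀ m (D : Subset m) (#D<m : ∣ D ∣ < m) → 1 ≤ ∣ D ∣ → frac (2 * ∣ D ∣) 1 ℚ.≤ c m D #D<m
c-lower (suc m) D #D<m 1≤#D = by-cases (ℚ.⊓-sel 1ℚ y)
  where
  δ = ∣ D ∣
  instance
    nz : NonZero (suc m ∸ δ)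
    nz = >-nonZero (m<n⇒0<n∸m #D<m)
  y : ℚ
  y = frac δ (suc m ∸ δ)
  by-cases : 1ℚ ℚ.⊓ y ≡ 1ℚ ⊎ 1ℚ ℚ.⊓ y ≡ y → frac (2 * δ) 1 ℚ.≤ frac (2 * m) 1 ℚ.* (1ℚ ℚ.⊓ y)
  by-cases (inj₁ eq) = subst (λ z → frac (2 * δ) 1 ℚ.≤ frac (2 * m) 1 ℚ.* z) (sym eq)
    (subst (frac (2 * δ) 1 ℚ.≤_) (sym (ℚ.*-identityʳ (frac (2 * m) 1)))
      (frac-≤ (2 * δ) 1 (2 * m) 1 (*-monoˡ-≤ 1 (*-monoʳ-≤ 2 (s≤s⁻¹ #D<m)))))
  by-cases (inj₂ eq) = subst (λ z → frac (2 * δ) 1 ℚ.≤ frac (2 * m) 1 ℚ.* z) (sym eq)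
    (subst (frac (2 * δ) 1 ℚ.≤_) (sym (frac-* (2 * m) 1 δ (suc m ∸ δ) {{_}} {{nz}} {{nz′}}))
      (frac-≤ (2 * δ) 1 (2 * m * δ) (1 * (suc m ∸ δ)) {{_}} {{nz′}} (begin
        2 * δ * (1 * (suc m ∸ δ))  ≤⟨ *-monoʳ-≤ (2 * δ) (*-monoʳ-≤ 1 (∸-monoʳ-≤ (suc m) 1≤#D)) ⟩
        2 * δ * (1 * m)            ≡⟨ alg δ m ⟩
        2 * m * δ * 1              ∎)))
    where
    open ≤-Reasoning
    nz′ : NonZero (1 * (suc m ∸ δ))
    nz′ = m*n≢0 1 (suc m ∸ δ)
    alg : ∀ δ m → 2 * δ * (1 * m) ≡ 2 * m * δ * 1
    alg = solve-∀

private
  int : ℤ → ℚ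
  int i = i / 1

int-- : ∀ i j → int i ℚ.- int j ≡ int (i ℤ.- j)
int-- i j = ℚ.toℚᵘ-injective (begin
  toℚᵘ (int i ℚ.- int j)                ≈⟨ ℚ.toℚᵘ-homo-+ (int i) (ℚ.- int j) ⟩
  toℚᵘ (int i) ℚᵘ.+ toℚᵘ (ℚ.- int j)    ≈⟨ ℚᵘ.+-congʳ (toℚᵘ (int i)) (ℚ.toℚᵘ-homo‿- (int j)) ⟩
  toℚᵘ (int i) ℚᵘ.- toℚᵘ (int j)        ≈⟨ ℚᵘ.+-cong (ℚ.toℚᵘ-fromℚᵘ (mkℚᵘ i 0)) (ℚᵘ.-‿cong (ℚ.toℚᵘ-fromℚᵘ (mkℚᵘ j 0))) ⟩
  mkℚᵘ i 0 ℚᵘ.- mkℚᵘ j 0                ≈⟨ *≡* (alg i j) ⟩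
  mkℚᵘ (i ℤ.- j) 0                      ≈⟨ ℚ.toℚᵘ-fromℚᵘ (mkℚᵘ (i ℤ.- j) 0) ⟨
  toℚᵘ (int (i ℤ.- j))                  ∎)
  where
  open ℚᵘ.≃-Reasoning
  alg : ∀ i j → (i ℤ.* + 1 ℤ.+ (ℤ.- j) ℤ.* + 1) ℤ.* + 1 ≡ (i ℤ.- j) ℤ.* + 1
  alg = ℤ-solve-∀

-- The fraction `i / 1` is in lowest terms, so it equals `mkℚ i 0`, whose numerator and denominator
-- compute. The condition of the cut becomes one on y^1.
log-int : ∀ {p y} i → p ^ᶻ i ≤ y → log p y (int i)
log-int {p} {y} i h = subst (log p y) (sym (ℚ.↥p/↧p≡p (mkℚ i 0 (λ (_ , d∣1) → ∣1⇒≡1 d∣1))))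
  (subst (p ^ᶻ i ≤_) (sym (ℚ.*-identityʳ y)) h)

-- Dividing by p^(a + b) gives p^(v - a - b) ≤ C ≤ y. The exponent may be negative, hence the case
-- split.
≤ᶜ-log : ∀ {p y} .{{_ : NonZero p}} v a b C → p ^ v ≤ p ^ (a + b) * C → frac C 1 ℚ.≤ y → v ≤ᶜ a ⊕ b ⊕ log p y
≤ᶜ-log {p} {y} v a b C pᵛ≤ C≤y = subst (log p y) (sym int-eq) (log-int (+ v ℤ.- + a ℤ.- + b) (by-cases (≤-<-connex (a + b) v)))
  where
  int-eq : int (+ v) ℚ.- int (+ a) ℚ.- int (+ b) ≡ int (+ v ℤ.- + a ℤ.- + b)
  int-eq = trans (cong (ℚ._- int (+ b)) (int-- (+ v) (+ a))) (int-- (+ v ℤ.- + a) (+ b))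
  exp = + v ℤ.- + a ℤ.- + b
  by-cases : a + b ≤ v ⊎ v < a + b → p ^ᶻ exp ≤ y
  by-cases (inj₁ ab≤v) with m≤n⇒∃[o]m+o≡n ab≤v
  ... | k , refl = subst (p ^ᶻ_≤ y) (sym (alg (+ a) (+ b) (+ k)))
    (subst (ℚ._≤ y) (sym (frac-^ p k)) (ℚ.≤-trans (frac-≤ (p ^ k) 1 C 1 (*-monoˡ-≤ 1 pᵏ≤C)) C≤y))
    where
    alg : ∀ a b k → (a ℤ.+ b ℤ.+ k) ℤ.- a ℤ.- b ≡ k
    alg = ℤ-solve-∀
    pᵏ≤C : p ^ k ≤ C
    pᵏ≤C = *-cancelˡ-≤ (p ^ (a + b)) {{m^n≢0 p (a + b)}} (subst (_≤ p ^ (a + b) * C) (^-distribˡ-+-* p (a + b) k) pᵛ≤)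
  -- Here v - a - b = -(k + 1), so the inequality to prove is the one multiplied through by p^(k +
  -- 1).
  by-cases (inj₂ v<ab) with m≤n⇒∃[o]m+o≡n v<ab
  ... | k , 1+v+k≡ab = subst (p ^ᶻ_≤ y) (sym exp≡)
    (ℚ.≤-trans (frac-≤ 1 1 (p ^ suc k * C) 1 (*-monoˡ-≤ 1 1≤pᵏC))
      (subst (ℚ._≤ frac p 1 ℚ^.^ suc k ℚ.* y) (trans (cong (ℚ._* frac C 1) (frac-^ p (suc k))) (frac-* (p ^ suc k) 1 C 1))
        (ℚ.*-monoˡ-≤-nonNeg (frac p 1 ℚ^.^ suc k) {{nonNeg}} C≤y)))
    where
    open ≡-Reasoning
    v+k≡ab : v + suc k ≡ a + b
    v+k≡ab = trans (+-suc v k) 1+v+k≡ab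
    alg₁ : ∀ v a b → v ℤ.- a ℤ.- b ≡ v ℤ.- (a ℤ.+ b)
    alg₁ = ℤ-solve-∀
    alg₂ : ∀ v k → v ℤ.- (v ℤ.+ k) ≡ ℤ.- k
    alg₂ = ℤ-solve-∀
    exp≡ : exp ≡ -[1+ k ]
    exp≡ = begin
      + v ℤ.- + a ℤ.- + b      ≡⟨ alg₁ (+ v) (+ a) (+ b) ⟩
      + v ℤ.- + (a + b)        ≡⟨ cong (λ z → + v ℤ.- + z) v+k≡ab ⟨
      + v ℤ.- + (v + suc k)    ≡⟨ alg₂ (+ v) (+ suc k) ⟩
      -[1+ k ]                 ∎
    1≤pᵏC : 1 ≤ p ^ suc k * C
    1≤pᵏC = *-cancelˡ-≤ (p ^ v) {{m^n≢0 p v}} (subst₂ _≤_ (sym (*-identityʳ (p ^ v)))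
      (trans (cong (λ z → p ^ z * C) (sym v+k≡ab)) (trans (cong (_* C) (^-distribˡ-+-* p v (suc k))) (*-assoc (p ^ v) (p ^ suc k) C))) pᵛ≤)
    nonNeg : ℚ.NonNegative (frac p 1 ℚ^.^ suc k)
    nonNeg = subst ℚ.NonNegative (sym (frac-^ p (suc k))) (ℚ.normalize-nonNeg (p ^ suc k) 1)

-- Digits of arithmetic progressions

-- The number of elements of D below x; it embeds D into `Fin ∣ D ∣`.
rank : ∀ {m} (D : Subset m) {x} → x ∈ D → Fin ∣ D ∣
rank (inside  ∷ D) here        = zero
rank (inside  ∷ D) (there x∈D) = suc (rank D x∈D)
rank (outside ∷ D) (there x∈D) = rank D x∈D

rank-injective : ∀ {m} (D : Subset m) {x y} (x∈D : x ∈ D) (y∈D : y ∈ D) → rank D x∈D ≡ rank D y∈D → x ≡ y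
rank-injective (inside  ∷ D) here        here        eq = refl
rank-injective (inside  ∷ D) (there x∈D) (there y∈D) eq = cong suc (rank-injective D x∈D y∈D (Fin.suc-injective eq))
rank-injective (outside ∷ D) (there x∈D) (there y∈D) eq = cong suc (rank-injective D x∈D y∈D eq)

injective-into⇒≤∣∣ : ∀ {n m} (D : Subset m) {f : Fin n → Fin m} → (∀ i → f i ∈ D) →
  Injective _≡_ _≡_ f → n ≤ ∣ D ∣
injective-into⇒≤∣∣ D f∈D inj = injective⇒≤ {f = λ i → rank D (f∈D i)} (inj ∘ rank-injective D (f∈D _) (f∈D _))

∃∉ : ∀ {m} (D : Subset m) → ∣ D ∣ < m → ∃[ x ] x ∉ D
∃∉ {m} D #D<m with any? (λ x → ¬? (x ∈? D))
... | yes ∃x = ∃x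
... | no ¬∃x = ⊥-elim (<⇒≱ #D<m (subst (_≤ ∣ D ∣) (∣⊤∣≡n m)
  (p⊆q⇒∣p∣≤∣q∣ {p = ⊤} (λ {x} _ → decidable-stable (x ∈? D) (λ x∉D → ¬∃x (x , x∉D))))))

-- A missed value could be punched out of the codomain, leaving an injection into a smaller finite
-- set.
injective⇒surjective : ∀ {n} {f : Fin n → Fin n} → Injective _≡_ _≡_ f → ∀ j → ∃[ i ] f i ≡ j
injective⇒surjective {suc n} {f} inj j with any? (λ i → f i Fin.≟ j)
... | yes ∃i = ∃i
... | no ¬∃i = ⊥-elim (1+n≰n (injective⇒≤ {f = λ i → punchOut (j≢f i)}
  (λ {i} {i′} eq → inj (punchOut-injective (j≢f i) (j≢f i′) eq))))
  where
  j≢f : ∀ i → j ≢ f i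
  j≢f i j≡fi = ¬∃i (i , sym j≡fi)

-- Slide the window [A, A + s) right by one. Either the chosen point stays inside, or it was the
-- left end A and its successor A + s is the last integer of the new window.
∃-step-in-window : ∀ A b s → b < s → ∃[ j ] A ≤ b + j * s × b + j * s < A + s
∃-step-in-window zero    b s b<s = 0 , z≤n , subst (_< s) (sym (+-identityʳ b)) b<s
∃-step-in-window (suc A) b s b<s with ∃-step-in-window A b s b<s
... | j , lower , upper with m≤n⇒m<n∨m≡n lower
...   | inj₁ A< = j , A< , m≤n⇒m≤1+n upper
...   | inj₂ refl = suc j , subst (suc A ≤_) eq (subst (_≤ A + s) (+-comm A 1) (+-monoʳ-≤ A (≤-trans z<s b<s))) , ≤-reflexive (cong suc (sym eq))
  where
  eq : b + j * s + s ≡ b + (s + j * s)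
  eq = alg b (j * s) s
    where
    alg : ∀ b x s → b + x + s ≡ b + (s + x)
    alg = solve-∀

*-window-unique : ∀ {a b x y} → a * x ≤ y → y < suc a * x → b * x ≤ y → y < suc b * x → a ≡ b
*-window-unique {a} {b} {x} lowerₐ upperₐ lowerᵦ upperᵦ = ≤-antisym
  (s≤s⁻¹ (*-cancelʳ-< x a (suc b) (≤-<-trans lowerₐ upperᵦ)))
  (s≤s⁻¹ (*-cancelʳ-< x b (suc a) (≤-<-trans lowerᵦ upperₐ)))

-- The digit of a point R / Q ∈ [0,1) is the d with d / m ≤ R / Q < (d + 1) / m.
HasDigitIn : ∀ {m} → Subset m → ℕ → ℕ → Set
HasDigitIn {m} D Q R = ∃[ d ] d ∈ D × toℕ d * Q ≤ m * R × m * R < suc (toℕ d) * Q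

module _ {m} (D : Subset m) (#D<m : ∣ D ∣ < m) {N G r₀ : ℕ} (r₀<G : r₀ < G)
  (digit : ∀ j → j < N → HasDigitIn D (N * G) (r₀ + j * G)) where

  progression-short : N ≤ m
  progression-short = ≮⇒≥ λ m<N →
    let d , d∉D = ∃∉ D #D<m
        mr₀<mG = *-monoʳ-< m {{>-nonZero (≤-<-trans z≤n #D<m)}} r₀<G
        -- Scaled by m N G, the points have step m G, while the interval of the missing digit d has
        -- length N G, which is at least m G when m < N. So the progression must hit it.
        j , lower , upper = ∃-step-in-window (toℕ d * (N * G)) (m * r₀) (m * G) mr₀<mG
        eq : m * r₀ + j * (m * G) ≡ m * (r₀ + j * G)
        eq = alg m r₀ j G
        mG≤NG = *-monoˡ-≤ G (<⇒≤ m<N)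
        upper′ : m * (r₀ + j * G) < suc (toℕ d) * (N * G)
        upper′ = subst₂ _<_ eq (+-comm (toℕ d * (N * G)) (N * G)) (<-≤-trans upper (+-monoʳ-≤ (toℕ d * (N * G)) mG≤NG))
        lower′ : toℕ d * (N * G) ≤ m * (r₀ + j * G)
        lower′ = subst (toℕ d * (N * G) ≤_) eq lower
        -- The interval of d ends at or below m N G, so the index found is less than N and the
        -- hypothesis on digits applies to it.
        jG<NG : j * G < N * G
        jG<NG = *-cancelˡ-< m (j * G) (N * G) (≤-<-trans (*-monoʳ-≤ m (m≤n+m (j * G) r₀))
                  (<-≤-trans upper′ (*-monoˡ-≤ (N * G) (toℕ<n d))))
        e , e∈D , lowerₑ , upperₑ = digit j (*-cancelʳ-< G j N jG<NG)
    in d∉D (subst (_∈ D) (toℕ-injective (*-window-unique lowerₑ upperₑ lower′ upper′)) e∈D)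
    where
    alg : ∀ m r j G → m * r + j * (m * G) ≡ m * (r + j * G)
    alg = solve-∀

  -- Since N ≤ m, distinct points are at least 1 / N ≥ 1 / m apart, too far for one half-open digit
  -- interval of length 1 / m.
  separated : ∀ {i j} (i<N : i < N) (j<N : j < N) → i < j → proj₁ (digit i i<N) ≢ proj₁ (digit j j<N)
  separated {i} {j} i<N j<N i<j eq
    with digit i i<N | digit j j<N
  ... | d , _ , lower , _ | e , _ , _ , upper rewrite eq = <⇒≱ upper (begin
    N * G + toℕ e * (N * G)             ≤⟨ +-mono-≤ (*-monoˡ-≤ G progression-short) lower ⟩
    m * G + m * (r₀ + i * G)            ≡⟨ alg m G r₀ i ⟩
    m * (r₀ + suc i * G)                ≤⟨ *-monoʳ-≤ m (+-monoʳ-≤ r₀ (*-monoˡ-≤ G i<j)) ⟩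
    m * (r₀ + j * G)                    ∎)
    where
    open ≤-Reasoning
    alg : ∀ m G r i → m * G + m * (r + i * G) ≡ m * (r + suc i * G)
    alg = solve-∀

  digit-injective : Injective _≡_ _≡_ (λ (j : Fin N) → proj₁ (digit (toℕ j) (toℕ<n j)))
  digit-injective {i} {j} eq with <-cmp (toℕ i) (toℕ j)
  ... | tri≈ _ i≡j _ = toℕ-injective i≡j
  ... | tri< i<j _ _ = ⊥-elim (separated (toℕ<n i) (toℕ<n j) i<j eq)
  ... | tri> _ _ j<i = ⊥-elim (separated (toℕ<n j) (toℕ<n i) j<i (sym eq))

  progression≤∣D∣ : N ≤ ∣ D ∣
  progression≤∣D∣ = injective-into⇒≤∣∣ D (λ j → proj₁ (proj₂ (digit (toℕ j) (toℕ<n j)))) digit-injective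

-- Coprimality and the orbit of r / Q under powers of m

prime∤⇒coprime : ∀ {p n} → Prime p → ¬ (p ∣ n) → Coprime p n
prime∤⇒coprime pr p∤n (d∣p , d∣n) with prime⇒irreducible pr d∣p
... | inj₁ d≡1  = d≡1
... | inj₂ refl = ⊥-elim (p∤n d∣n)

-- The bounds after k digits identify the integer part of m^k r / Q as M. Subtracting m M Q from the
-- bounds after k + 1 digits places the remainder in the interval of the digit `a (suc k)`.
K⇒orbit-digits : ∀ m .{{_ : NonZero m}} (D : Subset m) Q .{{_ : NonZero Q}} r → 2 ≤ Q →
  Coprime Q m → Coprime Q r → K m D (+ r / Q) → ∀ k → HasDigitIn D Q ((m ^ k * r) % Q)
K⇒orbit-digits m D Q r 2≤Q cop-m cop-r (a , a∈D , conv) k =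
  a (suc k) , a∈D (suc k) (s≤s z≤n) ,
  +-cancelˡ-≤ (m * M * Q) _ _ (subst₂ _≤_ (alg₁ (m * M) d Q) orbit (lower (suc k))) ,
  +-cancelˡ-< (m * M * Q) _ _ (subst₂ _<_ orbit (alg₂ (m * M) d Q) (upper (suc k)))
  where
  M = numerator m a k
  d = toℕ (a (suc k))
  y = m ^ k * r
  -- The limit gives only a weak upper bound. It is strict because Q ≥ 2 is coprime to r and m, so Q
  -- never divides r m^n.
  Q∤ : ∀ n → ¬ (Q ∣ r * m ^ n)
  Q∤ n Q∣ = <⇒≢ 2≤Q (sym (∣1⇒≡1 (coprime-divisor {Q} {m ^ n} {1} (coprime-^ n cop-m)
    (subst (Q ∣_) (sym (*-identityʳ (m ^ n))) (coprime-divisor cop-r Q∣)))))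
  lower : ∀ n → numerator m a n * Q ≤ r * m ^ n
  lower n = proj₁ (limit-bounds m a r Q conv n)
  upper : ∀ n → r * m ^ n < suc (numerator m a n) * Q
  upper n = ≤∧≢⇒< (proj₂ (limit-bounds m a r Q conv n)) (λ eq → Q∤ n (divides (suc (numerator m a n)) eq))
  y/Q≡M : y ℕ./ Q ≡ M
  y/Q≡M = *-window-unique {y ℕ./ Q} {M} {Q} {y} (m/n*n≤m y Q)
    (subst (_< Q + (y ℕ./ Q) * Q) (sym (m≡m%n+[m/n]*n y Q)) (+-monoˡ-< ((y ℕ./ Q) * Q) (m%n<n y Q)))
    (subst (M * Q ≤_) (*-comm r (m ^ k)) (lower k))
    (subst (_< suc M * Q) (*-comm r (m ^ k)) (upper k))
  alg₀ : ∀ r m x → r * (m * x) ≡ m * (x * r)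
  alg₀ = solve-∀
  alg₁ : ∀ x d q → (x + d) * q ≡ x * q + d * q
  alg₁ = solve-∀
  alg₂ : ∀ x d q → suc (x + d) * q ≡ x * q + suc d * q
  alg₂ = solve-∀
  alg₃ : ∀ m M q ρ → m * (ρ + M * q) ≡ m * M * q + m * ρ
  alg₃ = solve-∀
  orbit : r * m ^ suc k ≡ m * M * Q + m * (y % Q)
  orbit = begin
    r * (m * m ^ k)                 ≡⟨ alg₀ r m (m ^ k) ⟩
    m * y                           ≡⟨ cong (m *_) (m≡m%n+[m/n]*n y Q) ⟩
    m * (y % Q + (y ℕ./ Q) * Q)       ≡⟨ cong (λ z → m * (y % Q + z * Q)) y/Q≡M ⟩
    m * (y % Q + M * Q)             ≡⟨ alg₃ m M Q (y % Q) ⟩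
    m * M * Q + m * (y % Q)         ∎
    where open ≡-Reasoning

module Orbit (μ : ℕ) (D : Subset (suc μ)) (#D<m : ∣ D ∣ < suc μ) (1≤#D : 1 ≤ ∣ D ∣)
  {p} (pr : Prime p) (Q : ℕ) .{{_ : NonZero Q}} (r : ℕ)
  (cop-m : Coprime Q (suc μ)) (cop-r : Coprime Q r)
  (digits : ∀ k → HasDigitIn D Q ((suc μ ^ k * r) % Q))
  {o τ u : ℕ} (h≡ : powPred μ o ≡ p ^ τ * u) (p∤u : ¬ (p ∣ u)) (lift : Liftable p (p ^ τ * u))
  {e C : ℕ} (p∤C : ¬ (p ∣ C)) (q∣ : ∀ q → Prime q → q ∣ Q → q ∣ powPred μ (p ^ e * C))
  where

  private
    instance
      p≢0 : NonZero p
      p≢0 = prime⇒nonZero pr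
    v = ν p Q
    Q′ = proj₁ (ν-split Q pr)
    Q≡ : Q ≡ p ^ v * Q′
    Q≡ = proj₁ (proj₂ (ν-split Q pr))
    p∤Q′ = proj₂ (proj₂ (ν-split Q pr))
    instance
      Q′≢0 : NonZero Q′
      Q′≢0 = ≢-nonZero λ Q′≡0 → ≢-nonZero⁻¹ Q (trans Q≡ (trans (cong (p ^ v *_) Q′≡0) (*-zeroʳ (p ^ v))))
    h = p ^ τ * u
    L = p ^ e * C * Q′
    X = powPred h L
    G = p ^ (τ + e) * Q′
    instance
      G≢0 : NonZero G
      G≢0 = m*n≢0 (p ^ (τ + e)) Q′ {{m^n≢0 p (τ + e)}}

    L≡ : L ≡ p ^ e * (C * Q′)
    L≡ = *-assoc (p ^ e) C Q′

    p∤CQ′ : ¬ (p ∣ C * Q′)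
    p∤CQ′ p∣ = [ p∤C , p∤Q′ ]′ (euclidsLemma C Q′ pr p∣)

    -- The two coprime parts are treated apart. The factor p^e of L adds e to the valuation τ.
    -- Modulo each prime divisor of Q′ the power with exponent o p^e C is already 1, and the further
    -- exponent Q′ makes it 1 modulo Q′.
    G∣X : G ∣ X
    G∣X = p^k*n∣ (τ + e) pr p∤Q′ p^∣X Q′∣X
      where
      p^∣X : p ^ (τ + e) ∣ X
      p^∣X = subst₂ (λ a b → a ∣ powPred h b) (sym (^-distribˡ-+-* p τ e)) (sym L≡)
        (∣powPred-* h (p ^ e) (C * Q′) (p^k∣powPred {d = p ^ τ} e (proj₁ lift) (m∣m*n u)))
      q∣h^ : ∀ q → Prime q → q ∣ Q′ → q ∣ powPred h (p ^ e * C)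
      q∣h^ q prq q∣Q′ = subst (q ∣_)
        (trans (cong (powPred μ) (*-comm (p ^ e * C) o)) (trans (powPred-* μ o (p ^ e * C)) (cong (λ z → powPred z (p ^ e * C)) h≡)))
        (∣powPred-* μ (p ^ e * C) o (q∣ q prq (∣-trans q∣Q′ (divides (p ^ v) Q≡))))
      Q′∣X : Q′ ∣ X
      Q′∣X = subst (Q′ ∣_) (sym (powPred-* h (p ^ e * C) Q′)) (n∣powPred-n Q′ q∣h^)

    X-power : ∀ i → suc X ^ i ≡ suc μ ^ (o * L * i)
    X-power i = begin
      suc X ^ i                    ≡⟨ cong (_^ i) (suc-^ h L) ⟨
      (suc h ^ L) ^ i              ≡⟨ cong (λ z → (suc z ^ L) ^ i) h≡ ⟨
      (suc (powPred μ o) ^ L) ^ i  ≡⟨ cong (λ z → (z ^ L) ^ i) (suc-^ μ o) ⟨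
      ((suc μ ^ o) ^ L) ^ i        ≡⟨ cong (_^ i) (^-*-assoc (suc μ) o L) ⟩
      (suc μ ^ (o * L)) ^ i        ≡⟨ ^-*-assoc (suc μ) (o * L) i ⟩
      suc μ ^ (o * L * i)          ∎
      where open ≡-Reasoning

    point : ℕ → ℕ
    point i = (suc X ^ i * r) % Q

    point-digit : ∀ i → HasDigitIn D Q (point i)
    point-digit i = subst (λ z → HasDigitIn D Q ((z * r) % Q)) (sym (X-power i)) (digits (o * L * i))

    module _ {s} (v≡ : τ + e + s ≡ v) where
      N = p ^ s

      instance
        N≢0 : NonZero N
        N≢0 = m^n≢0 p s

      Q≡NG : Q ≡ N * G
      Q≡NG = begin
        Q                            ≡⟨ Q≡ ⟩
        p ^ v * Q′                   ≡⟨ cong (λ z → p ^ z * Q′) v≡ ⟨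
        p ^ (τ + e + s) * Q′         ≡⟨ cong (_* Q′) (^-distribˡ-+-* p (τ + e) s) ⟩
        p ^ (τ + e) * N * Q′         ≡⟨ cong (_* Q′) (*-comm (p ^ (τ + e)) N) ⟩
        N * p ^ (τ + e) * Q′         ≡⟨ *-assoc N _ Q′ ⟩
        N * G                        ∎
        where open ≡-Reasoning

      -- The multiplier 1 + X is 1 modulo G and G divides Q, so every point keeps the residue of r
      -- modulo G. Only the quotient by G varies.
      point≡ : ∀ i → point i ≡ r % G + point i ℕ./ G * G
      point≡ i = trans (m≡m%n+[m/n]*n (point i) G) (cong (_+ point i ℕ./ G * G) (begin
        point i % G                        ≡⟨ m∣n⇒o%n%m≡o%m G Q (suc X ^ i * r) (divides N Q≡NG) ⟩
        (suc X ^ i * r) % G                ≡⟨ cong (λ z → (z * r) % G) (suc-^ X i) ⟩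
        (r + powPred X i * r) % G          ≡⟨ %-remove-+ʳ r (∣m⇒∣m*n r (∣powPred i G∣X)) ⟩
        r % G                              ∎))
        where open ≡-Reasoning

      index : ℕ → Fin N
      index i = fromℕ< {point i ℕ./ G} (m<n*o⇒m/o<n (subst (point i <_) Q≡NG (m%n<n _ Q)))

      toℕ-index : ∀ i → toℕ (index i) ≡ point i ℕ./ G
      toℕ-index i = toℕ-fromℕ< _

      -- Equal indices mean equal points. Cancelling units leaves Q dividing (1 + X)^(k + 1) - 1,
      -- where k + 1 = j - i. Lifting the exponent gives p^(e + s) dividing L (k + 1). As L has
      -- exactly e factors p, N = p^s divides k + 1, which is positive and less than N.
      index-separates : ∀ {i j} → i < j → j < N → index i ≢ index j
      index-separates {i} {j} i<j j<N eq with m≤n⇒∃[o]m+o≡n i<j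
      ... | k , 1+i+k≡j = <⇒≱ j<N (≤-trans (∣⇒≤ N∣1+k) (≤-trans (s≤s (m≤n+m k i)) (≤-reflexive 1+i+k≡j)))
        where
        open ≡-Reasoning
        P = powPred X (suc k)
        alg : ∀ x P r → (x + x * P) * r ≡ x * r + x * (r * P)
        alg = solve-∀
        point≡point : point i ≡ (suc X ^ i * r + suc X ^ i * (r * P)) % Q
        point≡point = begin
          point i                              ≡⟨ point≡ i ⟩
          r % G + point i ℕ./ G * G              ≡⟨ cong (λ z → r % G + z * G) (trans (sym (toℕ-index i)) (trans (cong toℕ eq) (toℕ-index j))) ⟩
          r % G + point j ℕ./ G * G              ≡⟨ point≡ j ⟨
          (suc X ^ j * r) % Q                  ≡⟨ cong (λ z → (suc X ^ z * r) % Q) (trans (+-suc i k) 1+i+k≡j) ⟨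
          (suc X ^ (i + suc k) * r) % Q        ≡⟨ cong (λ z → (z * r) % Q) (suc-^-+ X i (suc k)) ⟩
          ((suc X ^ i + suc X ^ i * P) * r) % Q ≡⟨ cong (_% Q) (alg (suc X ^ i) P r) ⟩
          (suc X ^ i * r + suc X ^ i * (r * P)) % Q  ∎
        Q∣P : Q ∣ P
        Q∣P = coprime-divisor cop-r (coprime-divisor
          (subst (Coprime Q) (sym (X-power i)) (coprime-^ (o * L * i) cop-m))
          (%≡⇒∣ (suc X ^ i * r) _ point≡point))
        pᵛ∣ : p ^ (τ + (e + s)) ∣ powPred h (L * suc k)
        pᵛ∣ = subst₂ (λ a b → p ^ a ∣ b) (trans (sym v≡) (+-assoc τ e s)) (sym (powPred-* h L (suc k)))
          (∣-trans (divides Q′ (trans Q≡ (*-comm (p ^ v) Q′))) Q∣P)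
        N∣1+k : N ∣ suc k
        N∣1+k = p^[a+b]∣m*n e s pr p∤CQ′
          (subst (λ z → p ^ (e + s) ∣ z * suc k) L≡ (lte (e + s) τ u (L * suc k) pr p∤u lift pᵛ∣))

      index-injective : Injective _≡_ _≡_ (λ (i : Fin N) → index (toℕ i))
      index-injective {i} {j} eq with <-cmp (toℕ i) (toℕ j)
      ... | tri≈ _ i≡j _ = toℕ-injective i≡j
      ... | tri< i<j _ _ = ⊥-elim (index-separates i<j (toℕ<n j) eq)
      ... | tri> _ _ j<i = ⊥-elim (index-separates j<i (toℕ<n i) (sym eq))

      -- The N points have N distinct indices in `Fin N`, so every term of the progression is
      -- reached by some point.
      progression-digit : ∀ j → j < N → HasDigitIn D (N * G) (r % G + j * G)
      progression-digit j j<N with injective⇒surjective index-injective (fromℕ< j<N)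
      ... | i , index≡ = subst₂ (HasDigitIn D) Q≡NG point≡′ (point-digit (toℕ i))
        where
        point≡′ : point (toℕ i) ≡ r % G + j * G
        point≡′ = trans (point≡ (toℕ i)) (cong (λ z → r % G + z * G)
          (trans (sym (toℕ-index (toℕ i))) (trans (cong toℕ index≡) (toℕ-fromℕ< j<N))))

      N≤∣D∣ : N ≤ ∣ D ∣
      N≤∣D∣ = progression≤∣D∣ D #D<m (m%n<n r G) progression-digit

  p^ν≤ : p ^ ν p Q ≤ p ^ (τ + e) * ∣ D ∣
  p^ν≤ with ≤-total v (τ + e)
  ... | inj₁ v≤ = ≤-trans (^-monoʳ-≤ p v≤) (m≤m*n (p ^ (τ + e)) ∣ D ∣ {{>-nonZero 1≤#D}})
  ... | inj₂ ≤v with m≤n⇒∃[o]m+o≡n ≤v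
  ...   | s , v≡ = begin
    p ^ v                     ≡⟨ cong (p ^_) v≡ ⟨
    p ^ (τ + e + s)           ≡⟨ ^-distribˡ-+-* p (τ + e) s ⟩
    p ^ (τ + e) * p ^ s       ≤⟨ *-monoʳ-≤ (p ^ (τ + e)) (N≤∣D∣ v≡) ⟩
    p ^ (τ + e) * ∣ D ∣       ∎
    where open ≤-Reasoning

-- Choice of exponents and the final bound

powPred≢0 : ∀ h k .{{_ : NonZero h}} .{{_ : NonZero k}} → NonZero (powPred h k)
powPred≢0 h (suc k) = m*n≢0 h (geo (suc h) (suc k))

∤suc⇒2∣ : ∀ n → ¬ (2 ∣ suc n) → 2 ∣ n
∤suc⇒2∣ zero          _    = 2 ∣0
∤suc⇒2∣ (suc zero)    2∤2  = ⊥-elim (2∤2 ∣-refl)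
∤suc⇒2∣ (suc (suc n)) 2∤3+n = ∣m∣n⇒∣m+n ∣-refl (∤suc⇒2∣ n (λ 2∣ → 2∤3+n (∣m∣n⇒∣m+n ∣-refl 2∣)))

-- C is the product of the prime-to-p parts of the orders.
commonExponent : ∀ μ {p n} → Prime p → Coprime n (suc μ) → ∀ e qs →
  All (λ q → NonZero q × q ∣ n × ν p (ord q (suc μ)) ≤ e) qs →
  Σ[ C ∈ ℕ ] ¬ (p ∣ C) × All (_∣ powPred μ (p ^ e * C)) qs
commonExponent μ pr cop e [] [] = 1 , (λ p∣1 → ¬prime[1] (subst Prime (∣1⇒≡1 p∣1) pr)) , []
commonExponent μ {p} pr cop e (q ∷ qs) ((q≢0 , q∣n , νₒ≤e) ∷ hyps)
  with commonExponent μ pr cop e qs hyps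
     | ord-spec q μ {{q≢0}} (coprime-∣ˡ q∣n cop)
... | C , p∤C , q∣s | o≢0 , q∣ with ν-split (ord q (suc μ)) {{o≢0}} pr
...   | b , o≡ , p∤b = b * C , (λ p∣ → [ p∤b , p∤C ]′ (euclidsLemma b C pr p∣)) ,
    -- The order of m modulo q is p^ν b with ν ≤ e; multiplying it by p^(e - ν) C gives the common
    -- exponent p^e b C.
    subst (λ n → q ∣ powPred μ n) o*≡ (∣powPred-* μ o _ q∣) ∷
    All.map (λ {x} x∣ → subst (λ n → x ∣ powPred μ n) (alg₁ (p ^ e) C b) (∣powPred-* μ (p ^ e * C) b x∣)) q∣s
  where
  o = ord q (suc μ)
  alg₁ : ∀ x C b → x * C * b ≡ x * (b * C)
  alg₁ = solve-∀
  alg₂ : ∀ x y b C → x * b * (y * C) ≡ x * y * (b * C)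
  alg₂ = solve-∀
  o*≡ : o * (p ^ (e ∸ ν p o) * C) ≡ p ^ e * (b * C)
  o*≡ = begin
    o * (p ^ (e ∸ ν p o) * C)                   ≡⟨ cong (_* (p ^ (e ∸ ν p o) * C)) o≡ ⟩
    p ^ ν p o * b * (p ^ (e ∸ ν p o) * C)       ≡⟨ alg₂ (p ^ ν p o) (p ^ (e ∸ ν p o)) b C ⟩
    p ^ ν p o * p ^ (e ∸ ν p o) * (b * C)       ≡⟨ cong (_* (b * C)) (^-distribˡ-+-* p (ν p o) (e ∸ ν p o)) ⟨
    p ^ (ν p o + (e ∸ ν p o)) * (b * C)         ≡⟨ cong (λ z → p ^ z * (b * C)) (m+[n∸m]≡n νₒ≤e) ⟩
    p ^ e * (b * C)                             ∎
    where open ≡-Reasoning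

-- For p = 2 the lifting is started at m ^ 2 instead of m ^ ord_2(m) = m, whose
-- valuation ν 2 (m ^ 2 − 1) exceeds the overhead by one: this costs the factor 2.
overhead-bound : ∀ m (D : Subset m) (#D<m : ∣ D ∣ < m) → 1 ≤ ∣ D ∣ →
  ∀ {p} → 2 ≤ m → Prime p → ¬ (p ∣ m) → ∀ Q .{{_ : NonZero Q}} r → Coprime Q m → Coprime Q r →
  (∀ k → HasDigitIn D Q ((m ^ k * r) % Q)) →
  ∀ {e C} → ¬ (p ∣ C) → (∀ q → Prime q → q ∣ Q → q ∣ m ^ (p ^ e * C) ∸ 1) →
  p ^ ν p Q ≤ p ^ (overhead m p + e) * (2 * ∣ D ∣)
overhead-bound (suc μ) D #D<m 1≤#D {p} 2≤m pr p∤m Q r cop-m cop-r digits {e} {C} p∤C q∣ with p ≟ 2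
... | no p≢2 = begin
    p ^ ν p Q
      ≤⟨ Orbit.p^ν≤ μ D #D<m 1≤#D pr Q r cop-m cop-r digits {o} {ν p h} {u} h≡ p∤u lift {e} {C} p∤C q∣′ ⟩
    p ^ (ν p h + e) * ∣ D ∣
      -- Weakening by the factor 2 brings the odd case to the same form as p = 2.
      ≤⟨ *-monoʳ-≤ (p ^ (ν p h + e)) (m≤n*m ∣ D ∣ 2) ⟩
    p ^ (ν p h + e) * (2 * ∣ D ∣)
      ≡⟨ cong (λ z → p ^ (ν p z + e) * (2 * ∣ D ∣)) (powPred≡ μ o) ⟨
    p ^ (ν p (suc μ ^ o ∸ 1) + e) * (2 * ∣ D ∣) ∎
  where
  open ≤-Reasoning
  instance
    p≢0 : NonZero p
    p≢0 = prime⇒nonZero pr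
    μ≢0 : NonZero μ
    μ≢0 = >-nonZero (s≤s⁻¹ 2≤m)
  o = ord p (suc μ)
  spec = ord-spec p μ (prime∤⇒coprime pr p∤m)
  h = powPred μ o
  instance
    h≢0 : NonZero h
    h≢0 = powPred≢0 μ o {{μ≢0}} {{proj₁ spec}}
  u = proj₁ (ν-split h pr)
  h≡ = proj₁ (proj₂ (ν-split h pr))
  p∤u = proj₂ (proj₂ (ν-split h pr))
  lift : Liftable p (p ^ ν p h * u)
  lift = subst (Liftable p) h≡ (proj₂ spec , λ p≡2 → ⊥-elim (p≢2 p≡2))
  q∣′ : ∀ q → Prime q → q ∣ Q → q ∣ powPred μ (p ^ e * C)
  q∣′ q prq q∣Q = subst (q ∣_) (powPred≡ μ (p ^ e * C)) (q∣ q prq q∣Q)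
... | yes refl = begin
    2 ^ ν 2 Q
      ≤⟨ Orbit.p^ν≤ μ D #D<m 1≤#D pr Q r cop-m cop-r digits {2} {ν 2 h} {u} h≡ p∤u lift {e} {C} p∤C q∣′ ⟩
    2 ^ (ν 2 h + e) * ∣ D ∣
      ≡⟨ cong (λ z → 2 ^ (z + e) * ∣ D ∣) (m+[n∸m]≡n 1≤νh) ⟨
    2 * 2 ^ (ν 2 h ∸ 1 + e) * ∣ D ∣
      ≡⟨ alg (2 ^ (ν 2 h ∸ 1 + e)) ∣ D ∣ ⟩
    2 ^ (ν 2 h ∸ 1 + e) * (2 * ∣ D ∣)
      ≡⟨ cong (λ z → 2 ^ (ν 2 z ∸ 1 + e) * (2 * ∣ D ∣)) (powPred≡ μ 2) ⟨
    2 ^ (ν 2 (suc μ ^ 2 ∸ 1) ∸ 1 + e) * (2 * ∣ D ∣) ∎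
  where
  open ≤-Reasoning
  h = powPred μ 2
  instance
    h≢0 : NonZero h
    h≢0 = powPred≢0 μ 2 {{>-nonZero (s≤s⁻¹ 2≤m)}}
  u = proj₁ (ν-split h pr)
  h≡ = proj₁ (proj₂ (ν-split h pr))
  p∤u = proj₂ (proj₂ (ν-split h pr))
  alg : ∀ x d → 2 * x * d ≡ x * (2 * d)
  alg = solve-∀
  2∣μ : 2 ∣ μ
  2∣μ = ∤suc⇒2∣ μ p∤m
  -- As m is odd, both factors of m^2 - 1 = (m - 1)(m + 1) are even. This is the extra condition for
  -- lifting at 2.
  4∣h : 4 ∣ h
  4∣h = *-pres-∣ 2∣μ (subst (2 ∣_) (sym (geo-expand μ 2)) (∣m∣n⇒∣m+n ∣-refl (∣m⇒∣m*n (geoSum μ 2) 2∣μ)))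
  lift : Liftable 2 (2 ^ ν 2 h * u)
  lift = subst (Liftable 2) h≡ (∣-trans (divides 2 refl) 4∣h , λ _ → 4∣h)
  1≤νh : 1 ≤ ν 2 h
  1≤νh = p^k∣n⇒k≤ν h 1 ≤-refl (∣-trans (divides 2 refl) 4∣h)
  q∣′ : ∀ q → Prime q → q ∣ Q → q ∣ powPred μ (2 ^ e * C)
  q∣′ q prq q∣Q = subst (q ∣_) (powPred≡ μ (2 ^ e * C)) (q∣ q prq q∣Q)

proposition3p3 :
    (m : ℕ) .{{_ : NonZero m}} → 3 ≤ m →
    (D : Subset m) → 1 < ∣ D ∣ → (#D<m : ∣ D ∣ < m) →
    (p₀ : ℕ) → Prime p₀ → ¬ (p₀ ∣ m) →
    (Q : ℕ) .{{_ : NonZero Q}} → 2 ≤ Q → gcd Q m ≡ 1 →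
    (r : ℕ) → 0 < r → r < Q → gcd (m * r) Q ≡ 1 →
    K m D (+ r / Q) →
    (ν p₀ Q ≤ᶜ overhead m p₀ ⊕ ν p₀ (ord (rad Q) m) ⊕ log p₀ (c m D #D<m))
    × (ν p₀ Q ≤ᶜ overhead m p₀ ⊕ maxOverPrimeDivisors (λ p → ν p₀ (ord p m)) Q ⊕ log p₀ (c m D #D<m))
proposition3p3 m@(suc μ) 3≤m D 1<#D #D<m p₀ pr p₀∤m Q 2≤Q gcd≡1 r 0<r r<Q gcd-mr≡1 r/Q∈K =
  ≤ᶜ-log (ν p₀ Q) (overhead m p₀) (ν p₀ ω) (2 * ∣ D ∣) rad-bound (c-lower m D #D<m (<⇒≤ 1<#D)) ,
  ≤ᶜ-log (ν p₀ Q) (overhead m p₀) e (2 * ∣ D ∣) max-bound (c-lower m D #D<m (<⇒≤ 1<#D))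
  where
  instance
    p₀≢0 : NonZero p₀
    p₀≢0 = prime⇒nonZero pr
  cop-m : Coprime Q m
  cop-m = gcd≡1⇒coprime gcd≡1
  cop-r : Coprime Q r
  cop-r (d∣Q , d∣r) = gcd≡1⇒coprime gcd-mr≡1 (∣n⇒∣m*n m d∣r , d∣Q)
  bound = overhead-bound m D #D<m (<⇒≤ 1<#D) (<⇒≤ 3≤m) pr p₀∤m Q r cop-m cop-r
    (K⇒orbit-digits m D Q r 2≤Q cop-m cop-r r/Q∈K)

  ω = ord (rad Q) m
  instance
    rad≢0 : NonZero (rad Q)
    rad≢0 = productOfPrimes≢0 (All.map proj₁ (primeDivisors-All Q))
  ω-spec : NonZero ω × rad Q ∣ powPred μ ω
  ω-spec = ord-spec (rad Q) μ (product-coprime (primeDivisors Q) (All.map proj₂ (primeDivisors-All Q)) cop-m)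
  instance
    ω≢0 : NonZero ω
    ω≢0 = proj₁ ω-spec
  rad-bound : p₀ ^ ν p₀ Q ≤ p₀ ^ (overhead m p₀ + ν p₀ ω) * (2 * ∣ D ∣)
  -- The exponent W is the order modulo the radical itself, and C is its part prime to `p₀`.
  rad-bound with ν-split ω pr
  ... | C , ω≡ , p₀∤C = bound p₀∤C λ q prq q∣Q →
    subst (λ n → q ∣ m ^ n ∸ 1) ω≡ (subst (q ∣_) (sym (powPred≡ μ ω))
      (∣-trans (∈⇒∣product (∈primeDivisors prq q∣Q)) (proj₂ ω-spec)))

  e = maxOverPrimeDivisors (λ p → ν p₀ (ord p m)) Q
  max-bound : p₀ ^ ν p₀ Q ≤ p₀ ^ (overhead m p₀ + e) * (2 * ∣ D ∣)
  -- The exponent W is a common multiple of the orders modulo the prime divisors of Q, with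
  -- `p₀`-adic valuation equal to the maximum e.
  max-bound with commonExponent μ pr cop-m e (primeDivisors Q) (All.tabulate λ {q} q∈ →
    let prq , q∣Q = All.lookup (primeDivisors-All Q) q∈
    in prime⇒nonZero prq , q∣Q , All.lookup (xs≤max 0 _) (∈-map⁺ (λ p → ν p₀ (ord p m)) q∈))
  ... | C , p₀∤C , q∣s = bound p₀∤C λ q prq q∣Q →
    subst (q ∣_) (sym (powPred≡ μ (p₀ ^ e * C))) (All.lookup q∣s (∈primeDivisors prq q∣Q))
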